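{- Let $G$ be a connected graph. Then there is a homeomorphism $\mathrm{Ult}(\mathfrak{T}(G)) \to \Theta(G)$ from the ultrafilter space of the separation algebra $\mathfrak{T}(G)$ of $G$ onto the tangle space $\Theta(G)$ of $G$.
   Context: Graphs are simple and undirected, possibly infinite; $V(G)$, $E(G)$ are the vertex and edge sets, and for $E\subset E(G)$, $V(E)$ is the set of vertices incident with some edge of $E$. Ultrafilter space. For a Boolean algebra $\mathfrak B$ (the one-element algebra is allowed), a filter is a nonempty upward closed subset closed under $\wedge$ and not containing $0$; an ultrafilter is a maximal filter. $\mathrm{Ult}(\mathfrak B)$ is the set of ultrafilters with the topology whose basic open sets are $[B]=\{u : B\in u\}$, $B\in\mathfrak B$ (empty if $0=1$). Separation algebra. Let $\mathfrak t(G)=\{E\subset E(G) : V(E)\cap V(E(G)\setminus E)\text{ is finite}\}$, a Boolean subalgebra of $2^{E(G)}$, and let $F_G\subset\mathfrak t(G)$ be the ideal of finite sets of edges. The separation algebra is $\mathfrak T(G)=\mathfrak t(G)/F_G$ (two elements are identified when their symmetric difference is finite). Tangles. A separation of $G$ is $\{A,B\}$ with $A,B\subset V(G)$, $A\cup B=V(G)$, such that every edge of $G$ lies in $G[A]$ or in $G[B]$; its order is $|A\cap B|$. An orientation of $\{A,B\}$ is one of the ordered pairs $(A,B)$, $(B,A)$. An $\aleph_0$-orientation $\tau$ is a set containing exactly one orientation of each separation of finite order (and nothing else). Oriented separations $(A_1,B_1),\dots,(A_n,B_n)$ form a contradiction of order $n$ if $G[A_1]\cup\dots\cup G[A_n]=G$.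 An ($\aleph_0$-)tangle of $G$ is an $\aleph_0$-orientation with no contradictions of order $1$, $2$ or $3$ among its elements. $\Theta(G)$ is the set of all $\aleph_0$-tangles of $G$. Topology on $\Theta(G)$. For finite $F\subset V(G)$ let $\mathcal S_F$ be the set of vertex sets of the connected components of $G\setminus F$. The topology of $\Theta(G)$ is the one generated by the subbasis consisting of the sets $\{\tau\in\Theta(G) : (F\cup\bigcup(\mathcal S_F\setminus\mathcal A),\ F\cup\bigcup\mathcal A)\in\tau\}$, with $F\subset V(G)$ finite and $\mathcal A\subset\mathcal S_F$. (This is the inverse limit topology obtained by identifying $\tau$ with the compatible family of ultrafilters $x_\tau(F)=\{\mathcal A\subset\mathcal S_F : (F\cup\bigcup(\mathcal S_F\setminus\mathcal A),F\cup\bigcup\mathcal A)\in\tau\}$ in $\varprojlim_F\mathrm{Ult}(2^{\mathcal S_F})$.) -}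

module Defs where

open import Level using (Level; _⊔_; suc)
open import Algebra.Lattice.Bundles using (BooleanAlgebra)
import Algebra.Lattice.Properties.Lattice as LatticeProperties
open import Axiom.ExcludedMiddle using (ExcludedMiddle)
open import Data.Empty using (⊥-elim)
open import Data.Fin.Base using (Fin)
open import Data.List.Base using (List; []; _++_; filter)
import Data.List.Membership.Setoid as SetoidMembership
import Data.List.Membership.Setoid.Properties as MembershipProperties
open import Data.List.Relation.Unary.All using (All; [])
import Data.List.Relation.Unary.All as All
open import Data.List.Relation.Unary.All.Properties using (++⁺; ++⁻)
open import Data.Nat.Base using (ℕ) renaming (_≤_ to _≤ℕ_)
open import Data.Product.Base using (∃-syntax; _×_; _,_; proj₁; proj₂; swap)
open import Data.Sum.Base using (_⊎_; inj₁; inj₂; [_,_])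
import Data.Sum.Base as Sum
open import Data.Unit.Polymorphic.Base using (tt)
open import Function.Base using (_∘_; id)
open import Function.Bundles using (Inverse)
open import Relation.Binary.Bundles using (Setoid; Poset)
open import Relation.Binary.Core using (Rel)
open import Relation.Binary.Construct.Closure.ReflexiveTransitive using (Star)
open import Relation.Binary.Definitions using (Symmetric; Irreflexive; _Respects_)
open import Relation.Binary.PropositionalEquality using (_≡_)
import Relation.Binary.PropositionalEquality as ≡
open import Relation.Nullary using (¬_; Dec; yes; no)
open import Relation.Unary
  using (Pred; _∈_; _∉_; _⊆_; _≐_; _∪_; _∩_; _∖_; ∁; ⋃; _⊢_; Satisfiable)
open import Relation.Unary.Polymorphic using (∅; U)
open import Relation.Unary.Properties using (≐-refl; ≐-sym; ≐-trans)

private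
  variable
    b c e i p q ℓ : Level

module _ (S : Setoid c e) where
  open Setoid S using (Carrier; _≈_)
  open SetoidMembership S using () renaming (_∈_ to _∈ˡ_)

  Finite : Pred Carrier p → Set (c ⊔ e ⊔ p)
  Finite P = ∃[ xs ] P ≐ (_∈ˡ xs)

  ∅-finite : {P : Pred Carrier p} → (∀ {x} → x ∉ P) → Finite P
  ∅-finite x∉P = [] , ((λ x∈P → ⊥-elim (x∉P x∈P)) , λ ())

  ∪-finite : {P : Pred Carrier p} {Q : Pred Carrier q} →
             Finite P → Finite Q → Finite (P ∪ Q)
  ∪-finite (xs , P⊆ , ⊆P) (ys , Q⊆ , ⊆Q) = xs ++ ys ,
    [ ∈-++⁺ˡ S ∘ P⊆ , ∈-++⁺ʳ S xs ∘ Q⊆ ] ,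
    Sum.map ⊆P ⊆Q ∘ ∈-++⁻ S xs
    where open MembershipProperties

  ⊆-finite : ExcludedMiddle p → {P : Pred Carrier p} {Q : Pred Carrier q} →
             P Respects _≈_ → P ⊆ Q → Finite Q → Finite P
  ⊆-finite em {P} resp P⊆Q (xs , Q⊆ , _) = filter P? xs ,
    (λ x∈P → ∈-filter⁺ S P? resp (Q⊆ (P⊆Q x∈P)) x∈P) ,
    proj₂ ∘ ∈-filter⁻ S P? resp {xs = xs}
    where
    open MembershipProperties
    P? : ∀ x → Dec (P x)
    P? x = em

-- Subsets are predicates of one fixed level p. Under excluded middle every
-- predicate is equivalent to one of any given level, so p is immaterial.

record TopologicalSpace (c e p o : Level) : Set (suc (c ⊔ e ⊔ p ⊔ o)) where
  field
    points : Setoid c e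

  open Setoid points public using (_≈_) renaming (Carrier to Point)

  field
    Open        : Pred (Pred Point p) o
    open-resp-≈ : ∀ {W} → Open W → W Respects _≈_
    open-resp-≐ : ∀ {W W′} → W ≐ W′ → Open W → Open W′
    U-open      : Open U
    ∩-open      : ∀ {W W′} → Open W → Open W′ → Open (W ∩ W′)
    ⋃-open      : ∀ {I : Set p} {W : I → Pred Point p} →
                  (∀ k → Open (W k)) → Open (⋃ I W)

record Basis (S : Setoid c e) (i b : Level) : Set (c ⊔ e ⊔ suc (i ⊔ b)) where
  open Setoid S using (Carrier; _≈_)
  field
    Index  : Set i
    ⟦_⟧    : Index → Pred Carrier b
    resp   : ∀ k → ⟦ k ⟧ Respects _≈_
    covers : ∀ x → ∃[ k ] x ∈ ⟦ k ⟧
    refine : ∀ j k {x} → x ∈ ⟦ j ⟧ ∩ ⟦ k ⟧ →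
             ∃[ l ] x ∈ ⟦ l ⟧ × ⟦ l ⟧ ⊆ ⟦ j ⟧ ∩ ⟦ k ⟧

-- W is open iff it is a union of basic sets, stated pointwise.

fromBasis : {S : Setoid c e} → Basis S i b → (p : Level) →
            TopologicalSpace c e p (c ⊔ p ⊔ i ⊔ b)
fromBasis {S = S} B p = record
  { points      = S
  ; Open        = λ W → ∀ {x} → x ∈ W → ∃[ k ] x ∈ ⟦ k ⟧ × ⟦ k ⟧ ⊆ W
  ; open-resp-≈ = λ W-open x≈y x∈W → let (k , x∈k , k⊆W) = W-open x∈W in
                    k⊆W (resp k x≈y x∈k)
  ; open-resp-≐ = λ (W⊆W′ , W′⊆W) W-open x∈W′ →
                    let (k , x∈k , k⊆W) = W-open (W′⊆W x∈W′) in
                    k , x∈k , λ y∈k → W⊆W′ (k⊆W y∈k)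
  ; U-open      = λ {x} _ → let (k , x∈k) = covers x in k , x∈k , λ _ → tt
  ; ∩-open      = λ W-open W′-open (x∈W , x∈W′) →
                    let (j , x∈j , j⊆W)  = W-open x∈W
                        (k , x∈k , k⊆W′) = W′-open x∈W′
                        (l , x∈l , l⊆)   = refine j k (x∈j , x∈k)
                    in l , x∈l , λ y∈l → j⊆W (proj₁ (l⊆ y∈l)) , k⊆W′ (proj₂ (l⊆ y∈l))
  ; ⋃-open      = λ W-open (m , x∈W) → let (k , x∈k , k⊆W) = W-open m x∈W in
                    k , x∈k , λ y∈k → m , k⊆W y∈k
  }
  where open Basis B

finiteIntersections : (S : Setoid c e) {I : Set i} (B : I → Pred (Setoid.Carrier S) b) →
                      (∀ k → B k Respects Setoid._≈_ S) → Basis S i (i ⊔ b)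
finiteIntersections S {I = I} B resp = record
  { Index  = List I
  ; ⟦_⟧    = λ ks x → All (λ k → x ∈ B k) ks
  ; resp   = λ _ x≈y → All.map (λ {k} → resp k x≈y)
  ; covers = λ _ → [] , []
  ; refine = λ js ks (x∈js , x∈ks) → js ++ ks , ++⁺ x∈js x∈ks , ++⁻ js
  }

module _ {c₁ e₁ o₁ c₂ e₂ o₂ p : Level}
         (X : TopologicalSpace c₁ e₁ p o₁) (Y : TopologicalSpace c₂ e₂ p o₂) where
  private
    module X = TopologicalSpace X
    module Y = TopologicalSpace Y

  Continuous : (X.Point → Y.Point) → Set (c₂ ⊔ suc p ⊔ o₁ ⊔ o₂)
  Continuous f = ∀ {W} → Y.Open W → X.Open (f ⊢ W)

record Homeomorphism {c₁ e₁ o₁ c₂ e₂ o₂ p : Level}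
                     (X : TopologicalSpace c₁ e₁ p o₁) (Y : TopologicalSpace c₂ e₂ p o₂) :
                     Set (c₁ ⊔ e₁ ⊔ o₁ ⊔ c₂ ⊔ e₂ ⊔ o₂ ⊔ suc p) where
  field
    inverse : Inverse (TopologicalSpace.points X) (TopologicalSpace.points Y)

  open Inverse inverse public using (to; from)

  field
    to-continuous   : Continuous X Y to
    from-continuous : Continuous Y X from

module _ (𝔅 : BooleanAlgebra c ℓ) where
  open BooleanAlgebra 𝔅 using (Carrier; _∧_; ⊥; lattice)
  open LatticeProperties lattice using (poset)
  open Poset poset using (_≤_)

  record IsFilter (u : Pred Carrier p) : Set (c ⊔ ℓ ⊔ p) where
    field
      nonempty : Satisfiable u
      upward   : ∀ {x y} → x ≤ y → x ∈ u → y ∈ u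
      ∧-closed : ∀ {x y} → x ∈ u → y ∈ u → x ∧ y ∈ u
      ⊥∉       : ⊥ ∉ u

  record Ultrafilter : Set (suc (c ⊔ ℓ)) where
    field
      members  : Pred Carrier (c ⊔ ℓ)
      isFilter : IsFilter members
      maximal  : ∀ {w : Pred Carrier (c ⊔ ℓ)} → IsFilter w → members ⊆ w → w ⊆ members

  open Ultrafilter

  ultrafilterSetoid : Setoid (suc (c ⊔ ℓ)) (c ⊔ ℓ)
  ultrafilterSetoid = record
    { Carrier       = Ultrafilter
    ; _≈_           = λ u w → members u ≐ members w
    ; isEquivalence = record { refl = ≐-refl ; sym = ≐-sym ; trans = ≐-trans }
    }

  basicOpens : Basis ultrafilterSetoid c (c ⊔ ℓ)
  basicOpens = record
    { Index  = Carrier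
    ; ⟦_⟧    = λ x u → x ∈ members u
    ; resp   = λ _ (u⊆w , _) → u⊆w
    ; covers = λ u → IsFilter.nonempty (isFilter u)
    ; refine = λ x y {u} (x∈u , y∈u) → x ∧ y ,
        IsFilter.∧-closed (isFilter u) x∈u y∈u ,
        λ {w} xy∈w → IsFilter.upward (isFilter w) (x∧y≤x x y) xy∈w ,
                     IsFilter.upward (isFilter w) (x∧y≤y x y) xy∈w
    }
    where
    open import Relation.Binary.Lattice.Bundles using (MeetSemilattice)
    open MeetSemilattice (LatticeProperties.∧-orderTheoreticMeetSemilattice lattice)
      using (x∧y≤x; x∧y≤y)

  Ult : TopologicalSpace (suc (c ⊔ ℓ)) (c ⊔ ℓ) (suc (c ⊔ ℓ)) (suc (c ⊔ ℓ))
  Ult = fromBasis basicOpens (suc (c ⊔ ℓ))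

record Graph (ℓ : Level) : Set (suc ℓ) where
  field
    V          : Set ℓ
    Adj        : Rel V ℓ
    adj-sym    : Symmetric Adj
    adj-irrefl : Irreflexive _≡_ Adj

module _ (G : Graph ℓ) where
  open Graph G

  Connected : Set ℓ
  Connected = V × (∀ x y → Star Adj x y)

  vertexSetoid : Setoid ℓ ℓ
  vertexSetoid = ≡.setoid V

  FiniteV : Pred V p → Set (ℓ ⊔ p)
  FiniteV = Finite vertexSetoid

  record Edge : Set ℓ where
    constructor edge
    field
      {x y} : V
      adj   : Adj x y

  _endOf_ : V → Edge → Set ℓ
  v endOf edge {x} {y} _ = v ≡ x ⊎ v ≡ y

  -- Each undirected edge is represented in both directions, and Adj need
  -- not be proof-irrelevant; edges are equal iff they have the same ends.

  record _≈ᴱ_ (e f : Edge) : Set ℓ where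
    constructor same-ends
    field
      ends : (_endOf e) ≐ (_endOf f)

  ≈ᴱ-sym : Symmetric _≈ᴱ_
  ≈ᴱ-sym (same-ends p) = same-ends (≐-sym p)

  edgeSetoid : Setoid ℓ ℓ
  edgeSetoid = record
    { Carrier       = Edge
    ; _≈_           = _≈ᴱ_
    ; isEquivalence = record
      { refl  = same-ends ≐-refl
      ; sym   = ≈ᴱ-sym
      ; trans = λ (same-ends p) (same-ends q) → same-ends (≐-trans p q)
      }
    }

  FiniteE : Pred Edge p → Set (ℓ ⊔ p)
  FiniteE = Finite edgeSetoid

  V⟨_⟩ : Pred Edge ℓ → Pred V ℓ
  V⟨ E ⟩ v = ∃[ e ] e ∈ E × v endOf e

  E[_] : Pred V ℓ → Pred Edge ℓ
  E[ A ] (edge {x} {y} _) = x ∈ A × y ∈ A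

  -- The elements of 𝔱(G); the quotient 𝔗(G) = 𝔱(G)/F_G is the setoid on
  -- them with equality _≈ᵀ_.
  record EdgeSep : Set (suc ℓ) where
    field
      edges           : Pred Edge ℓ
      resp            : edges Respects _≈ᴱ_
      finite-boundary : FiniteV (V⟨ edges ⟩ ∩ V⟨ ∁ edges ⟩)

  open EdgeSep

  _△_ : Pred Edge ℓ → Pred Edge ℓ → Pred Edge ℓ
  P △ Q = (P ∖ Q) ∪ (Q ∖ P)

  record _≈ᵀ_ (E E′ : EdgeSep) : Set ℓ where
    constructor mod-finite
    field
      finite-difference : FiniteE (edges E △ edges E′)

  open _≈ᵀ_

  -- Predicates form a Boolean algebra, and V(E) ∩ V(E(G) ∖ E) behaves well
  -- under intersection and complement of E, only classically.

  module _ (em : ExcludedMiddle ℓ) where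
    private
      ∁-resp : ∀ {P : Pred Edge ℓ} → P Respects _≈ᴱ_ → ∁ P Respects _≈ᴱ_
      ∁-resp r e≈f e∉P f∈P = e∉P (r (≈ᴱ-sym e≈f) f∈P)

      △-resp : ∀ (E F : EdgeSep) → (edges E △ edges F) Respects _≈ᴱ_
      △-resp E F e≈f (inj₁ (p , q)) = inj₁ (resp E e≈f p , ∁-resp (resp F) e≈f q)
      △-resp E F e≈f (inj₂ (p , q)) = inj₂ (resp F e≈f p , ∁-resp (resp E) e≈f q)

      dne : ∀ {P : Set ℓ} → ¬ ¬ P → P
      dne {P} ¬¬P with em {P}
      ... | yes p = p
      ... | no ¬p = ⊥-elim (¬¬P ¬p)

      finV : ∀ {P Q : Pred V ℓ} → P ⊆ Q → FiniteV Q → FiniteV P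
      finV {P} = ⊆-finite vertexSetoid em (≡.subst P)

      △-⊆ : ∀ E F {Q : Pred Edge ℓ} → (edges E △ edges F) ⊆ Q → FiniteE Q → E ≈ᵀ F
      △-⊆ E F sub fin = mod-finite (⊆-finite edgeSetoid em (△-resp E F) sub fin)

      ≐⇒≈ᵀ : ∀ E F → edges E ≐ edges F → E ≈ᵀ F
      ≐⇒≈ᵀ E F (E⊆F , F⊆E) = mod-finite (∅-finite edgeSetoid
        [ (λ (x∈E , x∉F) → x∉F (E⊆F x∈E)) , (λ (x∈F , x∉E) → x∉E (F⊆E x∈F)) ])

      ≈ᵀ-sym : ∀ E F → E ≈ᵀ F → F ≈ᵀ E
      ≈ᵀ-sym E F E≈F = △-⊆ F E Sum.swap (finite-difference E≈F)

      ≈ᵀ-trans : ∀ E F H → E ≈ᵀ F → F ≈ᵀ H → E ≈ᵀ H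
      ≈ᵀ-trans E F H E≈F F≈H = △-⊆ E H sub (∪-finite edgeSetoid (finite-difference E≈F) (finite-difference F≈H))
        where
        sub : (edges E △ edges H) ⊆ ((edges E △ edges F) ∪ (edges F △ edges H))
        sub {x} s with em {edges F x}
        sub (inj₁ (x∈E , x∉H)) | yes x∈F = inj₂ (inj₁ (x∈F , x∉H))
        sub (inj₁ (x∈E , x∉H)) | no  x∉F = inj₁ (inj₁ (x∈E , x∉F))
        sub (inj₂ (x∈H , x∉E)) | yes x∈F = inj₁ (inj₂ (x∈F , x∉E))
        sub (inj₂ (x∈H , x∉E)) | no  x∉F = inj₂ (inj₂ (x∈H , x∉F))

    _∨ᵀ_ _∧ᵀ_ : EdgeSep → EdgeSep → EdgeSep
    E ∨ᵀ F = record
      { edges           = edges E ∪ edges F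
      ; resp            = λ e≈f → Sum.map (resp E e≈f) (resp F e≈f)
      ; finite-boundary = finV sub (∪-finite vertexSetoid (finite-boundary E) (finite-boundary F))
      }
      where
      sub : (V⟨ edges E ∪ edges F ⟩ ∩ V⟨ ∁ (edges E ∪ edges F) ⟩) ⊆
            ((V⟨ edges E ⟩ ∩ V⟨ ∁ (edges E) ⟩) ∪ (V⟨ edges F ⟩ ∩ V⟨ ∁ (edges F) ⟩))
      sub ((e , inj₁ e∈E , v∈e) , (f , f∉ , v∈f)) =
        inj₁ ((e , e∈E , v∈e) , (f , f∉ ∘ inj₁ , v∈f))
      sub ((e , inj₂ e∈F , v∈e) , (f , f∉ , v∈f)) =
        inj₂ ((e , e∈F , v∈e) , (f , f∉ ∘ inj₂ , v∈f))
    E ∧ᵀ F = record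
      { edges           = edges E ∩ edges F
      ; resp            = λ e≈f (p , q) → resp E e≈f p , resp F e≈f q
      ; finite-boundary = finV sub (∪-finite vertexSetoid (finite-boundary E) (finite-boundary F))
      }
      where
      sub : (V⟨ edges E ∩ edges F ⟩ ∩ V⟨ ∁ (edges E ∩ edges F) ⟩) ⊆
            ((V⟨ edges E ⟩ ∩ V⟨ ∁ (edges E) ⟩) ∪ (V⟨ edges F ⟩ ∩ V⟨ ∁ (edges F) ⟩))
      sub ((e , (e∈E , e∈F) , v∈e) , (f , f∉ , v∈f)) with em {edges E f}
      ... | yes f∈E = inj₂ ((e , e∈F , v∈e) , (f , (λ f∈F → f∉ (f∈E , f∈F)) , v∈f))
      ... | no  f∉E = inj₁ ((e , e∈E , v∈e) , (f , f∉E , v∈f))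

    ¬ᵀ_ : EdgeSep → EdgeSep
    ¬ᵀ E = record
      { edges           = ∁ (edges E)
      ; resp            = ∁-resp (resp E)
      ; finite-boundary = finV (λ (v∈∁E , (f , f∉∁E , v∈f)) → (f , dne f∉∁E , v∈f) , v∈∁E)
                               (finite-boundary E)
      }

    ⊤ᵀ ⊥ᵀ : EdgeSep
    ⊤ᵀ = record
      { edges           = U
      ; resp            = λ _ _ → tt
      ; finite-boundary = ∅-finite vertexSetoid (λ (_ , (_ , f∉U , _)) → f∉U tt)
      }
    ⊥ᵀ = record
      { edges           = ∅
      ; resp            = λ _ ()
      ; finite-boundary = ∅-finite vertexSetoid (λ { ((_ , () , _) , _) })
      }

    separationAlgebra : BooleanAlgebra (suc ℓ) ℓ
    separationAlgebra = record
      { Carrier = EdgeSep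
      ; _≈_     = _≈ᵀ_
      ; _∨_     = _∨ᵀ_
      ; _∧_     = _∧ᵀ_
      ; ¬_      = ¬ᵀ_
      ; ⊤       = ⊤ᵀ
      ; ⊥       = ⊥ᵀ
      ; isBooleanAlgebra = record
        { isDistributiveLattice = record
          { isLattice = record
            { isEquivalence = record
              { refl  = λ {E} → ≐⇒≈ᵀ E E ≐-refl
              ; sym   = λ {E F} → ≈ᵀ-sym E F
              ; trans = λ {E F H} → ≈ᵀ-trans E F H
              }
            ; ∨-comm     = λ E F → ≐⇒≈ᵀ (E ∨ᵀ F) (F ∨ᵀ E) (Sum.swap , Sum.swap)
            ; ∨-assoc    = λ E F H → ≐⇒≈ᵀ ((E ∨ᵀ F) ∨ᵀ H) (E ∨ᵀ (F ∨ᵀ H)) (Sum.assocʳ , Sum.assocˡ)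
            ; ∨-cong     = λ {E E′ F F′} → ∨-cong E E′ F F′
            ; ∧-comm     = λ E F → ≐⇒≈ᵀ (E ∧ᵀ F) (F ∧ᵀ E) (swap , swap)
            ; ∧-assoc    = λ E F H → ≐⇒≈ᵀ ((E ∧ᵀ F) ∧ᵀ H) (E ∧ᵀ (F ∧ᵀ H))
                             ((λ ((p , q) , r) → p , q , r) , (λ (p , q , r) → (p , q) , r))
            ; ∧-cong     = λ {E E′ F F′} → ∧-cong E E′ F F′
            ; absorptive = (λ E F → ≐⇒≈ᵀ (E ∨ᵀ (E ∧ᵀ F)) E ([ id , proj₁ ] , inj₁))
                         , (λ E F → ≐⇒≈ᵀ (E ∧ᵀ (E ∨ᵀ F)) E (proj₁ , λ p → p , inj₁ p))
            }
          ; ∨-distrib-∧ =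
              (λ E F H → ≐⇒≈ᵀ (E ∨ᵀ (F ∧ᵀ H)) ((E ∨ᵀ F) ∧ᵀ (E ∨ᵀ H))
                ( [ (λ p → inj₁ p , inj₁ p) , (λ (q , r) → inj₂ q , inj₂ r) ]
                , λ { (inj₁ p , _) → inj₁ p ; (inj₂ _ , inj₁ p) → inj₁ p
                    ; (inj₂ q , inj₂ r) → inj₂ (q , r) }))
            , (λ E F H → ≐⇒≈ᵀ ((F ∧ᵀ H) ∨ᵀ E) ((F ∨ᵀ E) ∧ᵀ (H ∨ᵀ E))
                ( [ (λ (q , r) → inj₁ q , inj₁ r) , (λ p → inj₂ p , inj₂ p) ]
                , λ { (inj₂ p , _) → inj₂ p ; (inj₁ _ , inj₂ p) → inj₂ p
                    ; (inj₁ q , inj₁ r) → inj₁ (q , r) }))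
          ; ∧-distrib-∨ =
              (λ E F H → ≐⇒≈ᵀ (E ∧ᵀ (F ∨ᵀ H)) ((E ∧ᵀ F) ∨ᵀ (E ∧ᵀ H))
                ( (λ { (p , inj₁ q) → inj₁ (p , q) ; (p , inj₂ r) → inj₂ (p , r) })
                , [ (λ (p , q) → p , inj₁ q) , (λ (p , r) → p , inj₂ r) ]))
            , (λ E F H → ≐⇒≈ᵀ ((F ∨ᵀ H) ∧ᵀ E) ((F ∧ᵀ E) ∨ᵀ (H ∧ᵀ E))
                ( (λ { (inj₁ q , p) → inj₁ (q , p) ; (inj₂ r , p) → inj₂ (r , p) })
                , [ (λ (q , p) → inj₁ q , p) , (λ (r , p) → inj₂ r , p) ]))
          }
        ; ∨-complement =
            (λ E → ≐⇒≈ᵀ ((¬ᵀ E) ∨ᵀ E) ⊤ᵀ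
              ((λ _ → tt) , λ _ → Sum.swap (em∨ E)))
          , (λ E → ≐⇒≈ᵀ (E ∨ᵀ (¬ᵀ E)) ⊤ᵀ ((λ _ → tt) , λ _ → em∨ E))
        ; ∧-complement =
            (λ E → ≐⇒≈ᵀ ((¬ᵀ E) ∧ᵀ E) ⊥ᵀ ((λ (n , p) → ⊥-elim (n p)) , λ ()))
          , (λ E → ≐⇒≈ᵀ (E ∧ᵀ (¬ᵀ E)) ⊥ᵀ ((λ (p , n) → ⊥-elim (n p)) , λ ()))
        ; ¬-cong = λ {E F} E≈F → △-⊆ (¬ᵀ E) (¬ᵀ F)
            [ (λ (x∉E , x∉∁F) → inj₂ (dne x∉∁F , x∉E))
            , (λ (x∉F , x∉∁E) → inj₁ (dne x∉∁E , x∉F)) ] (finite-difference E≈F)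
        }
      }
      where
      em∨ : ∀ E {x} → x ∈ edges E ∪ ∁ (edges E)
      em∨ E {x} with em {edges E x}
      ... | yes p = inj₁ p
      ... | no ¬p = inj₂ ¬p

      ∨-cong : ∀ E E′ F F′ → E ≈ᵀ E′ → F ≈ᵀ F′ → (E ∨ᵀ F) ≈ᵀ (E′ ∨ᵀ F′)
      ∨-cong E E′ F F′ E≈ F≈ = △-⊆ (E ∨ᵀ F) (E′ ∨ᵀ F′)
        (λ { (inj₁ (inj₁ p , n)) → inj₁ (inj₁ (p , n ∘ inj₁))
           ; (inj₁ (inj₂ q , n)) → inj₂ (inj₁ (q , n ∘ inj₂))
           ; (inj₂ (inj₁ p , n)) → inj₁ (inj₂ (p , n ∘ inj₁))
           ; (inj₂ (inj₂ q , n)) → inj₂ (inj₂ (q , n ∘ inj₂)) })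
        (∪-finite edgeSetoid (finite-difference E≈) (finite-difference F≈))

      ∧-cong : ∀ E E′ F F′ → E ≈ᵀ E′ → F ≈ᵀ F′ → (E ∧ᵀ F) ≈ᵀ (E′ ∧ᵀ F′)
      ∧-cong E E′ F F′ E≈ F≈ = △-⊆ (E ∧ᵀ F) (E′ ∧ᵀ F′) sub (∪-finite edgeSetoid (finite-difference E≈) (finite-difference F≈))
        where
        sub : (edges (E ∧ᵀ F) △ edges (E′ ∧ᵀ F′)) ⊆
              ((edges E △ edges E′) ∪ (edges F △ edges F′))
        sub {x} (inj₁ ((p , q) , n)) with em {edges E′ x}
        ... | yes p′ = inj₂ (inj₁ (q , λ q′ → n (p′ , q′)))
        ... | no ¬p′ = inj₁ (inj₁ (p , ¬p′))
        sub {x} (inj₂ ((p , q) , n)) with em {edges E x}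
        ... | yes p′ = inj₂ (inj₂ (q , λ q′ → n (p′ , q′)))
        ... | no ¬p′ = inj₁ (inj₂ (p , ¬p′))

  record IsFiniteSeparation (A B : Pred V ℓ) : Set ℓ where
    field
      vertices     : ∀ v → v ∈ A ∪ B
      edges        : ∀ e → e ∈ E[ A ] ∪ E[ B ]
      finite-order : FiniteV (A ∩ B)

  OrientedPair : Set (suc ℓ)
  OrientedPair = Pred V ℓ × Pred V ℓ

  -- G[A₁] ∪ … ∪ G[Aₙ] = G, where Aₖ = proj₁ (s k).
  IsContradiction : {n : ℕ} → (Fin n → OrientedPair) → Set ℓ
  IsContradiction s = (∀ v → ∃[ k ] v ∈ proj₁ (s k)) × (∀ e → ∃[ k ] e ∈ E[ proj₁ (s k) ])

  -- Exactly one orientation of each {A , B}: (A , B) and (B , A) can both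
  -- belong to τ only if they are the same ordered pair.
  record IsOrientation (τ : Pred OrientedPair (suc ℓ)) : Set (suc ℓ) where
    field
      resp      : ∀ {A A′ B B′} → A ≐ A′ → B ≐ B′ → (A , B) ∈ τ → (A′ , B′) ∈ τ
      separates : ∀ {A B} → (A , B) ∈ τ → IsFiniteSeparation A B
      orients   : ∀ {A B} → IsFiniteSeparation A B → (A , B) ∈ τ ⊎ (B , A) ∈ τ
      unique    : ∀ {A B} → (A , B) ∈ τ → (B , A) ∈ τ → A ≐ B

  record Tangle : Set (suc (suc ℓ)) where
    field
      members          : Pred OrientedPair (suc ℓ)
      isOrientation    : IsOrientation members
      no-contradiction : ∀ {n} → 1 ≤ℕ n → n ≤ℕ 3 → (s : Fin n → OrientedPair) →
                         (∀ k → s k ∈ members) → ¬ IsContradiction s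

  tangleSetoid : Setoid (suc (suc ℓ)) (suc ℓ)
  tangleSetoid = record
    { Carrier       = Tangle
    ; _≈_           = λ σ τ → Tangle.members σ ≐ Tangle.members τ
    ; isEquivalence = record { refl = ≐-refl ; sym = ≐-sym ; trans = ≐-trans }
    }

  module _ (F : Pred V ℓ) where

    AdjOutside : Rel V ℓ
    AdjOutside x y = Adj x y × x ∉ F × y ∉ F

    -- A component of G ∖ F is represented by any of its vertices; two
    -- representatives are equal iff they span the same vertex set.

    Component : Set ℓ
    Component = ∃[ v ] v ∉ F

    vertexSet : Component → Pred V ℓ
    vertexSet (v , _) = Star AdjOutside v

    _≈ᶜ_ : Rel Component ℓ
    C ≈ᶜ D = vertexSet C ≐ vertexSet D

    ⋃ᶜ : Pred Component ℓ → Pred V ℓ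
    ⋃ᶜ 𝒜 = ⋃ (Satisfiable 𝒜) λ (C , _) → vertexSet C

  record SubbasisIndex : Set (suc ℓ) where
    field
      F      : Pred V ℓ
      finite : FiniteV F
      𝒜      : Pred (Component F) ℓ
      resp   : 𝒜 Respects _≈ᶜ_ F

  subbasicOpen : SubbasisIndex → Pred Tangle (suc ℓ)
  subbasicOpen k τ = (F ∪ ⋃ᶜ F (∁ 𝒜) , F ∪ ⋃ᶜ F 𝒜) ∈ Tangle.members τ
    where open SubbasisIndex k

  Θ : TopologicalSpace (suc (suc ℓ)) (suc ℓ) (suc (suc ℓ)) (suc (suc ℓ))
  Θ = fromBasis (finiteIntersections tangleSetoid subbasicOpen λ _ (σ⊆τ , _) → σ⊆τ)
                (suc (suc ℓ))

{-# OPTIONS --safe #-}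

-- An ultrafilter u orients a finite-order separation {A , B} towards the side
-- B with E[B] ∈ u: as E[A] ∪ E[B] is everything and E[A ∩ B] is finite,
-- exactly one side qualifies, and a contradiction would make the empty meet of
-- the sets ∁ E[Aₖ] a member of u.  Conversely, a tangle τ yields the sets of
-- edges that contain almost all of E[B] for some (A , B) ∈ τ.  These form an
-- ultrafilter because every E in the separation algebra is E[V(E)] up to
-- finitely many edges and {∁ V(E) ∪ V(∁ E) , V(E)} has finite order.
-- Connectedness is used only to see that E[B] is infinite for (A , B) ∈ τ: it
-- leaves at most one vertex without edges.  The last separation is moreover
-- the subbasic one given by F = V(E) ∩ V(∁ E) and the components of G ∖ F that
-- meet V(E), so the two topologies have the same (sub)basic sets.

module Submission where

open import Defs
open import Algebra.Lattice.Bundles using (BooleanAlgebra)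
import Algebra.Lattice.Properties.BooleanAlgebra as BooleanAlgebraProperties
open import Axiom.DoubleNegationElimination using (em⇒dne)
open import Axiom.ExcludedMiddle using (ExcludedMiddle)
open import Data.Fin.Base using (Fin; zero; suc)
open import Data.List.Base using (List; []; _∷_; concatMap)
import Data.List.Membership.Setoid as SetoidMembership
open import Data.List.Relation.Unary.All using (All; []; _∷_)
open import Data.List.Relation.Unary.Any using (here; there)
import Data.List.Relation.Unary.Any as Any
open import Data.List.Relation.Unary.Any.Properties using (concatMap⁺)
open import Data.Nat.Base using (ℕ; z≤n; s≤s)
open import Data.Product.Base using (Σ-syntax; ∃-syntax; _×_; _,_; proj₁; proj₂)
open import Data.Sum.Base using (_⊎_; inj₁; inj₂; [_,_]; swap)
import Data.Sum.Base as Sum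
open import Data.Unit.Polymorphic.Base using (tt)
import Data.Vec.Functional as Vector
open import Function.Base using (_∘_; id; case_of_)
open import Level using (Level; _⊔_)
open import Relation.Binary.Bundles using (Poset)
open import Relation.Binary.Construct.Closure.ReflexiveTransitive
  using (Star; ε; _◅_; _◅◅_; reverse)
open import Relation.Binary.Definitions using (_Respects_)
open import Relation.Binary.Lattice.Bundles using (MeetSemilattice)
open import Relation.Binary.PropositionalEquality using (refl; subst)
import Relation.Binary.Reasoning.Setoid as SetoidReasoning
open import Relation.Nullary using (¬_; yes; no; contradiction)
open import Relation.Unary using (Pred; _∈_; _∉_; _⊆_; _≐_; _∪_; _∩_; _∖_; ∁; Satisfiable)
open import Relation.Unary.Polymorphic using (U)
open import Relation.Unary.Properties using (≐-refl; ≐-sym; ≐-trans)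

private
  variable
    c ℓ p : Level

-- Filters and ultrafilters of a Boolean algebra

module _ (𝔅 : BooleanAlgebra c ℓ) where
  open BooleanAlgebra 𝔅 renaming (¬_ to infix 8 ¬ᴮ_) hiding (refl)
  open BooleanAlgebraProperties 𝔅
    using (poset; ∧-zeroʳ; ∧-identityʳ; ∨-identityˡ; ∧-orderTheoreticMeetSemilattice)
  open MeetSemilattice ∧-orderTheoreticMeetSemilattice using (x∧y≤x; x∧y≤y; ∧-greatest)
  open Poset poset using (_≤_) renaming (trans to ≤-trans)

  x∧y≤⊥⇒x≤¬y : ∀ {x y} → x ∧ y ≤ ⊥ → x ≤ ¬ᴮ y
  x∧y≤⊥⇒x≤¬y {x} {y} x∧y≤⊥ = begin
    x                          ≈⟨ ∧-identityʳ x ⟨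
    x ∧ ⊤                      ≈⟨ ∧-congˡ (∨-complementʳ y) ⟨
    x ∧ (y ∨ ¬ᴮ y)             ≈⟨ ∧-distribˡ-∨ x y (¬ᴮ y) ⟩
    -- The order is `x ≤ y` iff `x ≈ x ∧ y`, so the hypothesis is itself an equation that can be
    -- substituted.
    (x ∧ y) ∨ (x ∧ ¬ᴮ y)       ≈⟨ ∨-congʳ x∧y≤⊥ ⟩
    ((x ∧ y) ∧ ⊥) ∨ (x ∧ ¬ᴮ y) ≈⟨ ∨-congʳ (∧-zeroʳ (x ∧ y)) ⟩
    ⊥ ∨ (x ∧ ¬ᴮ y)             ≈⟨ ∨-identityˡ (x ∧ ¬ᴮ y) ⟩
    x ∧ ¬ᴮ y                   ∎
    where open SetoidReasoning setoid

  module _ {u : Pred Carrier p} (u-filter : IsFilter 𝔅 u) where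
    open IsFilter u-filter

    x∈filter⇒¬x∉filter : ∀ {x} → x ∈ u → ¬ᴮ x ∉ u
    x∈filter⇒¬x∉filter {x} x∈u ¬x∈u = ⊥∉ (upward x∧¬x≤⊥ (∧-closed x∈u ¬x∈u))
      where
      open SetoidReasoning setoid
      x∧¬x≤⊥ : x ∧ ¬ᴮ x ≤ ⊥
      x∧¬x≤⊥ = begin
        x ∧ ¬ᴮ x       ≈⟨ ∧-complementʳ x ⟩
        ⊥              ≈⟨ ∧-zeroʳ (x ∧ ¬ᴮ x) ⟨
        (x ∧ ¬ᴮ x) ∧ ⊥ ∎

    -- The filter generated by `u` and `x`; it contains `⊥` if `¬ᴮ x ∈ u`.
    adjoin : Carrier → Pred Carrier (c ⊔ ℓ ⊔ p)
    adjoin x y = ∃[ z ] z ∈ u × z ∧ x ≤ y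

    adjoin-isFilter : ∀ {x} → ¬ᴮ x ∉ u → IsFilter 𝔅 (adjoin x)
    adjoin-isFilter {x} ¬x∉u = record
      { nonempty = let (z , z∈u) = nonempty in x , z , z∈u , x∧y≤y z x
      ; upward   = λ y≤y′ (z , z∈u , zx≤y) → z , z∈u , ≤-trans zx≤y y≤y′
      ; ∧-closed = λ (z , z∈u , zx≤y) (z′ , z′∈u , z′x≤y′) →
          z ∧ z′ , ∧-closed z∈u z′∈u ,
          ∧-greatest (≤-trans (shrink (x∧y≤x z z′)) zx≤y) (≤-trans (shrink (x∧y≤y z z′)) z′x≤y′)
      ; ⊥∉       = λ (z , z∈u , zx≤⊥) → ¬x∉u (upward (x∧y≤⊥⇒x≤¬y zx≤⊥) z∈u)
      }
      where
      shrink : ∀ {w z} → w ≤ z → w ∧ x ≤ z ∧ x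
      shrink {w} w≤z = ∧-greatest (≤-trans (x∧y≤x w x) w≤z) (x∧y≤y w x)

  -- If `¬ᴮ x ∉ u`, then `adjoin x` is a filter above `u`, and maximality returns `x` to `u`. For
  -- `p = c ⊔ ℓ` the level of `adjoin x` is again `c ⊔ ℓ`, as `maximal` demands.
  ultrafilter-prime : ExcludedMiddle (c ⊔ ℓ) → (u : Ultrafilter 𝔅) →
                      ∀ x → x ∈ Ultrafilter.members u ⊎ ¬ᴮ x ∈ Ultrafilter.members u
  ultrafilter-prime em u x with em {¬ᴮ x ∈ Ultrafilter.members u}
  ... | yes ¬x∈u = inj₂ ¬x∈u
  ... | no  ¬x∉u = inj₁ (maximal (adjoin-isFilter isFilter ¬x∉u)
                          (λ {y} y∈u → y , y∈u , x∧y≤x y x)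
                          (let (z , z∈u) = nonempty in z , z∈u , x∧y≤y z x))
    where
    open Ultrafilter u
    open IsFilter isFilter using (nonempty)

  -- An element of a larger filter `w` that is missing from `u` would have its complement in `u`,
  -- hence also in `w`.
  prime⇒ultrafilter : {u : Pred Carrier (c ⊔ ℓ)} → IsFilter 𝔅 u →
                      (∀ x → x ∈ u ⊎ ¬ᴮ x ∈ u) → Ultrafilter 𝔅
  prime⇒ultrafilter {u} u-filter prime = record
    { members  = u
    ; isFilter = u-filter
    ; maximal  = λ w-filter u⊆w {x} x∈w →
        [ id , (λ ¬x∈u → contradiction (u⊆w ¬x∈u) (x∈filter⇒¬x∉filter w-filter x∈w)) ] (prime x)
    }

module _ {ℓ : Level} (em : ∀ {a} → ExcludedMiddle a) (G : Graph ℓ) where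
  open Graph G
  open SetoidMembership (vertexSetoid G) using () renaming (_∈_ to _∈ⱽ_)
  open SetoidMembership (edgeSetoid G) using () renaming (_∈_ to _∈ᴱ_)
  open EdgeSep using (edges; resp; finite-boundary)
  open IsFiniteSeparation using (vertices; finite-order) renaming (edges to covers-edges)

  private
    𝔗 : BooleanAlgebra _ _
    𝔗 = separationAlgebra G em

    open BooleanAlgebra 𝔗 using (⊥; _∧_) renaming (¬_ to ¬ᴮ_)
    open Poset (BooleanAlgebraProperties.poset 𝔗) using (_≤_)

    variable
      A B C D : Pred V ℓ
      P Q R : Pred (Edge G) ℓ

  -- Finite sets of vertices and edges, and inclusion modulo finite sets

  FiniteV-⊆ : A ⊆ B → FiniteV G B → FiniteV G A
  FiniteV-⊆ {A} = ⊆-finite (vertexSetoid G) em (subst A)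

  FiniteE-⊆ : P Respects (_≈ᴱ_ G) → P ⊆ Q → FiniteE G Q → FiniteE G P
  FiniteE-⊆ = ⊆-finite (edgeSetoid G) em

  ∖-resp : P Respects (_≈ᴱ_ G) → Q Respects (_≈ᴱ_ G) → (P ∖ Q) Respects (_≈ᴱ_ G)
  ∖-resp P-resp Q-resp e≈f (e∈P , e∉Q) =
    P-resp e≈f e∈P , e∉Q ∘ Q-resp (≈ᴱ-sym G e≈f)

  E[]-end : ∀ A e {v} → e ∈ E[ G ] A → (G endOf v) e → v ∈ A
  E[]-end A e (x∈A , y∈A) (inj₁ refl) = x∈A
  E[]-end A e (x∈A , y∈A) (inj₂ refl) = y∈A

  -- Equal edges may store their ends in opposite orders, so membership is carried over through
  -- `endOf`.
  E[]-resp : ∀ A → (E[ G ] A) Respects (_≈ᴱ_ G)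
  E[]-resp A {e} (same-ends (_ , f⊆e)) e∈A =
    E[]-end A e e∈A (f⊆e (inj₁ refl)) , E[]-end A e e∈A (f⊆e (inj₂ refl))

  ⊆E[V⟨⟩] : P ⊆ E[ G ] (V⟨ G ⟩ P)
  ⊆E[V⟨⟩] {x = e} e∈P = (e , e∈P , inj₁ refl) , (e , e∈P , inj₂ refl)

  E[]-finite : FiniteV G A → FiniteE G (E[ G ] A)
  E[]-finite {A} (xs , A⊆xs , _) =
    FiniteE-⊆ (E[]-resp A) A⊆es (es , id , id)
    where
    -- At most one edge per ordered pair suffices: all proofs of `Adj x y` give equal edges.
    joining : V → V → List (Edge G)
    joining x y with em {P = Adj x y}
    ... | yes a = edge a ∷ []
    ... | no  _ = []

    ∈-joining : ∀ {x y} (a : Adj x y) → edge a ∈ᴱ joining x y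
    ∈-joining {x} {y} a with em {P = Adj x y}
    ... | yes _ = here (same-ends ≐-refl)
    ... | no ¬a = contradiction a ¬a

    es : List (Edge G)
    es = concatMap (λ x → concatMap (joining x) xs) xs

    A⊆es : E[ G ] A ⊆ (_∈ᴱ es)
    A⊆es {edge a} (x∈A , y∈A) = concatMap⁺ _ (Any.map
      (λ { refl → concatMap⁺ _ (Any.map (λ { refl → ∈-joining a }) (A⊆xs y∈A)) }) (A⊆xs x∈A))

  V⟨⟩-finite : FiniteE G P → FiniteV G (V⟨ G ⟩ P)
  V⟨⟩-finite {P} (es , P⊆es , _) =
    FiniteV-⊆ P⊆ends (concatMap ends es , id , id)
    where
    ends : Edge G → List V
    ends e = Edge.x e ∷ Edge.y e ∷ []

    ∈-ends : ∀ {v f} → (G endOf v) f → v ∈ⱽ ends f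
    ∈-ends (inj₁ v≡x) = here v≡x
    ∈-ends (inj₂ v≡y) = there (here v≡y)

    P⊆ends : V⟨ G ⟩ P ⊆ (_∈ⱽ concatMap ends es)
    P⊆ends (e , e∈P , v∈e) = concatMap⁺ ends (Any.map
      (λ {f} (same-ends (e⊆f , _)) → ∈-ends {f = f} (e⊆f v∈e)) (P⊆es e∈P))

  -- Almost inclusion. On elements of the separation algebra it is the order of the quotient, by
  -- `⊆*⇒≤` and `≤⇒⊆*`.
  _⊆*_ : Pred (Edge G) ℓ → Pred (Edge G) ℓ → Set ℓ
  P ⊆* Q = FiniteE G (P ∖ Q)

  ⊆*-trans : P Respects (_≈ᴱ_ G) → R Respects (_≈ᴱ_ G) → P ⊆* Q → Q ⊆* R → P ⊆* R
  ⊆*-trans {P} {R} {Q} P-resp R-resp P⊆*Q Q⊆*R =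
    FiniteE-⊆ (∖-resp P-resp R-resp) split (∪-finite (edgeSetoid G) P⊆*Q Q⊆*R)
    where
    split : P ∖ R ⊆ (P ∖ Q) ∪ (Q ∖ R)
    split {e} (e∈P , e∉R) with em {P = Q e}
    ... | yes e∈Q = inj₂ (e∈Q , e∉R)
    ... | no  e∉Q = inj₁ (e∈P , e∉Q)

  -- `E ≤ F` means `E ≈ᵀ E ∧ F`, and the symmetric difference of `E` and `E ∧ F` consists of the
  -- edges of `E` outside `F`.
  ⊆*⇒≤ : ∀ E F → edges E ⊆* edges F → E ≤ F
  ⊆*⇒≤ E F E⊆*F = mod-finite (FiniteE-⊆ △-resp
    [ (λ (e∈E , e∉E∩F) → e∈E , λ e∈F → e∉E∩F (e∈E , e∈F))
    , (λ ((e∈E , _) , e∉E) → contradiction e∈E e∉E) ] E⊆*F)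
    where
    △-resp : (_△_ G (edges E) (edges (E ∧ F))) Respects (_≈ᴱ_ G)
    △-resp e≈f = Sum.map (∖-resp (resp E) (resp (E ∧ F)) e≈f)
                         (∖-resp (resp (E ∧ F)) (resp E) e≈f)

  ≤⇒⊆* : ∀ E F → E ≤ F → edges E ⊆* edges F
  ≤⇒⊆* E F (mod-finite fin) = FiniteE-⊆ (∖-resp (resp E) (resp F))
    (λ (e∈E , e∉F) → inj₁ (e∈E , e∉F ∘ proj₂)) fin

  -- Vertex separations and the edge sets of their sides

  IsFiniteSeparation-swap : IsFiniteSeparation G A B → IsFiniteSeparation G B A
  IsFiniteSeparation-swap s = record
    { vertices     = swap ∘ vertices s
    ; edges        = swap ∘ covers-edges s
    ; finite-order = FiniteV-⊆ (λ (p , q) → q , p) (finite-order s)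
    }

  sideEdges : IsFiniteSeparation G A B → EdgeSep G
  sideEdges {A} {B} s = record
    { edges           = E[ G ] B
    ; resp            = E[]-resp B
    ; finite-boundary = FiniteV-⊆ boundary⊆ (finite-order s)
    }
    where
    -- An edge outside `E[ G ] B` lies in `E[ G ] A`, so any vertex it shares with an edge of
    -- `E[ G ] B` is in `A ∩ B`.
    boundary⊆ : V⟨ G ⟩ (E[ G ] B) ∩ V⟨ G ⟩ (∁ (E[ G ] B)) ⊆ A ∩ B
    boundary⊆ ((e , e∈B , v∈e) , (f , f∉B , v∈f)) with covers-edges s f
    ... | inj₁ f∈A = E[]-end A f f∈A v∈f , E[]-end B e e∈B v∈e
    ... | inj₂ f∈B = contradiction f∈B f∉B

  -- An edge on both sides has both ends in the finite set `A ∩ B`.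
  sides-almost-disjoint : IsFiniteSeparation G A B → E[ G ] A ⊆* ∁ (E[ G ] B)
  sides-almost-disjoint {A} s = FiniteE-⊆
    (∖-resp (E[]-resp A) (resp (¬ᴮ sideEdges s)))
    (λ ((x∈A , y∈A) , e∉∁B) → let (x∈B , y∈B) = em⇒dne em e∉∁B in
      (x∈A , x∈B) , (y∈A , y∈B))
    (E[]-finite (finite-order s))

  -- The vertex separation induced by an element of the separation algebra

  module _ (E : EdgeSep G) where

    -- Writing `outside` as `boundary` together with a complement matches the form
    -- `F ∪ ⋃ᶜ G F (∁ 𝒜)` of a subbasic pair. Vertices without edges fall in `outside`.
    boundary outside inside : Pred V ℓ
    boundary = V⟨ G ⟩ (edges E) ∩ V⟨ G ⟩ (∁ (edges E))
    outside  = boundary ∪ ∁ (V⟨ G ⟩ (edges E))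
    inside   = V⟨ G ⟩ (edges E)

    ∉⇒outside : ∀ {e v} → e ∉ edges E → (G endOf v) e → v ∈ outside
    ∉⇒outside {v = v} e∉E v∈e with em {P = v ∈ inside}
    ... | yes v∈E = inj₁ (v∈E , _ , e∉E , v∈e)
    ... | no  v∉E = inj₂ v∉E

    outside∩inside⊆boundary : outside ∩ inside ⊆ boundary
    outside∩inside⊆boundary (inj₁ v∈∂E , _)   = v∈∂E
    outside∩inside⊆boundary (inj₂ v∉E  , v∈E) = contradiction v∈E v∉E

    canonicalSeparation : IsFiniteSeparation G outside inside
    canonicalSeparation = record
      { vertices     = λ v → case em {P = v ∈ inside} of λ
          { (yes v∈E) → inj₂ v∈E ; (no v∉E) → inj₁ (inj₂ v∉E) }
      ; edges        = λ e → case em {P = e ∈ edges E} of λ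
          { (yes e∈E) → inj₂ (⊆E[V⟨⟩] e∈E)
          ; (no  e∉E) → inj₁ (∉⇒outside e∉E (inj₁ refl) , ∉⇒outside e∉E (inj₂ refl)) }
      ; finite-order = FiniteV-⊆ outside∩inside⊆boundary (finite-boundary E)
      }

    -- An edge outside `E` whose ends both meet `E` has both ends in the finite boundary.
    E[inside]⊆* : E[ G ] inside ⊆* edges E
    E[inside]⊆* = FiniteE-⊆ (∖-resp (E[]-resp inside) (resp E))
      (λ { {e} ((x∈E , y∈E) , e∉E) →
           (x∈E , e , e∉E , inj₁ refl) , (y∈E , e , e∉E , inj₂ refl) })
      (E[]-finite (finite-boundary E))

    E[outside]⊆* : E[ G ] outside ⊆* ∁ (edges E)
    E[outside]⊆* = FiniteE-⊆ (∖-resp (E[]-resp outside) (resp (¬ᴮ E)))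
      (λ { ((x∈ , y∈) , e∉∁E) → let (x∈E , y∈E) = ⊆E[V⟨⟩] (em⇒dne em e∉∁E) in
           outside∩inside⊆boundary (x∈ , x∈E) , outside∩inside⊆boundary (y∈ , y∈E) })
      (E[]-finite (finite-boundary E))

    -- All edges at a vertex of V(E) off the boundary belong to `E`. Hence a component of G minus
    -- the boundary that meets V(E) lies inside V(E).
    step-inside : ∀ {x y} → AdjOutside G boundary x y → x ∈ inside → y ∈ inside
    step-inside (a , x∉∂E , _) x∈E with em {P = edge a ∈ edges E}
    ... | yes e∈E = edge a , e∈E , inj₂ refl
    ... | no  e∉E = contradiction (x∈E , edge a , e∉E , inj₁ refl) x∉∂E

    walk-inside : ∀ {x y} → Star (AdjOutside G boundary) x y → x ∈ inside → y ∈ inside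
    walk-inside ε        x∈E = x∈E
    walk-inside (a ◅ as) x∈E = walk-inside as (step-inside a x∈E)

    -- Asking that the component meet `inside`, rather than that its representative lie there, makes
    -- `resp` immediate; by `walk-inside` the two conditions agree.
    canonicalIndex : SubbasisIndex G
    canonicalIndex = record
      { F      = boundary
      ; finite = finite-boundary E
      ; 𝒜      = λ C → Satisfiable (vertexSet G boundary C ∩ inside)
      ; resp   = λ (C⊆D , _) (v , v∈C , v∈E) → v , C⊆D v∈C , v∈E
      }

    open SubbasisIndex canonicalIndex using (𝒜)

    reverse-walk : ∀ {x y} → Star (AdjOutside G boundary) x y → Star (AdjOutside G boundary) y x
    reverse-walk = reverse λ (a , x∉ , y∉) → adj-sym a , y∉ , x∉

    outside≐ : outside ≐ boundary ∪ ⋃ᶜ G boundary (∁ 𝒜)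
    outside≐ = Sum.map₂ to , [ inj₁ , from ]
      where
      to : ∀ {v} → v ∉ inside → v ∈ ⋃ᶜ G boundary (∁ 𝒜)
      -- The component of `v` itself is the witness: if it met `inside`, walking back would put `v`
      -- there.
      to {v} v∉E = ((v , v∉E ∘ proj₁) ,
        λ (w , v⇝w , w∈E) → v∉E (walk-inside (reverse-walk v⇝w) w∈E)) , ε

      from : ∀ {v} → v ∈ ⋃ᶜ G boundary (∁ 𝒜) → v ∈ outside
      from {v} ((C , C∉𝒜) , v∈C) = inj₂ λ v∈E → C∉𝒜 (v , v∈C , v∈E)

    inside≐ : inside ≐ boundary ∪ ⋃ᶜ G boundary 𝒜
    inside≐ = to , [ proj₁ , from ]
      where
      to : ∀ {v} → v ∈ inside → v ∈ boundary ∪ ⋃ᶜ G boundary 𝒜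
      to {v} v∈E with em {P = v ∈ boundary}
      ... | yes v∈∂E = inj₁ v∈∂E
      ... | no  v∉∂E = inj₂ (((v , v∉∂E) , v , ε , v∈E) , ε)

      from : ∀ {v} → v ∈ ⋃ᶜ G boundary 𝒜 → v ∈ inside
      from ((C , w , w∈C , w∈E) , v∈C) = walk-inside (reverse-walk w∈C ◅◅ v∈C) w∈E

  -- From ultrafilters to tangles

  module _ (u : Ultrafilter 𝔗) where
    open Ultrafilter u
    open IsFilter isFilter

    ⊆*-upward : ∀ E F → edges E ⊆* edges F → E ∈ members → F ∈ members
    ⊆*-upward E F E⊆*F = upward {E} {F} (⊆*⇒≤ E F E⊆*F)

    -- The inclusions are exact, not merely up to finitely many edges, so that when the complements
    -- of the sets `E k` cover all edges the bound has no edge at all.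
    lower-bound : ∀ {n} (E : Fin n → EdgeSep G) → (∀ k → E k ∈ members) →
                  ∃[ F ] F ∈ members × (∀ k → edges F ⊆ edges (E k))
    lower-bound {ℕ.zero}  E E∈u = let (F , F∈u) = nonempty in F , F∈u , λ ()
    lower-bound {ℕ.suc n} E E∈u =
      let (F , F∈u , F⊆) = lower-bound (E ∘ suc) (E∈u ∘ suc) in
      E zero ∧ F , ∧-closed {E zero} {F} (E∈u zero) F∈u ,
      λ { zero → proj₁ ; (suc k) → F⊆ k ∘ proj₂ }

    -- The proof `s` is carried along because `sideEdges` is built from it; two such proofs give the
    -- same edge set.
    Oriented : Pred (OrientedPair G) (Level.suc ℓ)
    Oriented (A , B) = Σ[ s ∈ IsFiniteSeparation G A B ] sideEdges s ∈ members

    ∁-small-side : ((s , _) : (A , B) ∈ Oriented) →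
                   (¬ᴮ sideEdges (IsFiniteSeparation-swap s)) ∈ members
    ∁-small-side (s , B∈u) = ⊆*-upward (sideEdges s) (¬ᴮ sideEdges s′)
      (sides-almost-disjoint s′) B∈u
      where s′ = IsFiniteSeparation-swap s

    inducedTangle : Tangle G
    inducedTangle = record
      { members          = Oriented
      ; isOrientation    = record
        { resp      = λ (A⊆A′ , A′⊆A) (B⊆B′ , B′⊆B) (s , B∈u) →
            let s′ = record
                  { vertices     = λ v → Sum.map A⊆A′ B⊆B′ (vertices s v)
                  ; edges        = λ e → Sum.map (λ (x , y) → A⊆A′ x , A⊆A′ y)
                                                 (λ (x , y) → B⊆B′ x , B⊆B′ y) (covers-edges s e)
                  ; finite-order = FiniteV-⊆ (λ (x , y) → A′⊆A x , B′⊆B y) (finite-order s)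
                  }
            in s′ , ⊆*-upward (sideEdges s) (sideEdges s′)
              (∅-finite (edgeSetoid G) λ ((x∈B , y∈B) , e∉B′) → e∉B′ (B⊆B′ x∈B , B⊆B′ y∈B)) B∈u
        ; separates = proj₁
        ; orients   = λ s → let s′ = IsFiniteSeparation-swap s in
            Sum.map (s ,_)
              (λ ∁B∈u → s′ , ⊆*-upward (¬ᴮ sideEdges s) (sideEdges s′)
                (∅-finite (edgeSetoid G) λ {e} (e∉B , e∉A) → [ e∉A , e∉B ] (covers-edges s e)) ∁B∈u)
              (ultrafilter-prime 𝔗 em u (sideEdges s))
        -- Both orientations would put `E[ G ] A` and its complement in `u`. The two proofs that
        -- `(B , A)` is a separation may differ, hence the passage across an empty difference.
        ; unique    = λ (s , B∈u) (s′ , A∈u) → contradiction (∁-small-side (s , B∈u))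
            (x∈filter⇒¬x∉filter 𝔗 isFilter {sideEdges (IsFiniteSeparation-swap s)}
              (⊆*-upward (sideEdges s′) (sideEdges (IsFiniteSeparation-swap s))
                (∅-finite (edgeSetoid G) λ (e∈A , e∉A) → e∉A e∈A) A∈u))
        }
      ; no-contradiction = λ _ _ s s∈ (_ , covers) →
          let (F , F∈u , F⊆) = lower-bound
                (λ k → ¬ᴮ sideEdges (IsFiniteSeparation-swap (proj₁ (s∈ k))))
                (λ k → ∁-small-side (s∈ k))
          in ⊥∉ (⊆*-upward F ⊥
            (∅-finite (edgeSetoid G) λ {e} (e∈F , _) →
              let (k , e∈Aₖ) = covers e in F⊆ k e∈F e∈Aₖ) F∈u)
      }

  -- From tangles to ultrafilters

  module _ (connected : Connected G) (τ : Tangle G) where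
    open Tangle τ
    open IsOrientation isOrientation renaming (resp to members-resp)

    not-three : ∀ {A B C D A′ B′} → (A , B) ∈ members → (C , D) ∈ members → (A′ , B′) ∈ members →
                ¬ ((∀ v → v ∈ A ∪ C ∪ A′) × (∀ e → e ∈ E[ G ] A ∪ E[ G ] C ∪ E[ G ] A′))
    not-three {A} {B} {C} {D} {A′} {B′} p q r (vs , es) =
      no-contradiction (s≤s z≤n) (s≤s (s≤s (s≤s z≤n)))
        ((A , B) Vector.∷ (C , D) Vector.∷ (A′ , B′) Vector.∷ Vector.[])
        (λ { zero → p ; (suc zero) → q ; (suc (suc zero)) → r })
        ((λ v → [ zero ,_ , [ suc zero ,_ , suc (suc zero) ,_ ] ] (vs v)) ,
         (λ e → [ zero ,_ , [ suc zero ,_ , suc (suc zero) ,_ ] ] (es e)))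

    -- Listing the second pair twice gives a contradiction of order 3.
    not-two : (A , B) ∈ members → (C , D) ∈ members →
              ¬ ((∀ v → v ∈ A ∪ C) × (∀ e → e ∈ E[ G ] A ∪ E[ G ] C))
    not-two p q (vs , es) = not-three p q q (Sum.map₂ inj₁ ∘ vs , Sum.map₂ inj₁ ∘ es)

    -- If `B` were finite, `τ` would orient {B, V}. Choosing `(B , U)` contradicts `(A , B)`, since
    -- the two sides cover G; choosing `(U , B)` is a contradiction by itself.
    big-side-infinite : (A , B) ∈ members → ¬ FiniteV G B
    big-side-infinite {A} {B} AB∈τ B-finite with orients B-sep
      where
      B-sep : IsFiniteSeparation G B U
      B-sep = record
        { vertices     = λ _ → inj₂ tt
        ; edges        = λ _ → inj₂ (tt , tt)
        ; finite-order = FiniteV-⊆ proj₁ B-finite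
        }
    ... | inj₁ BV∈τ = not-two AB∈τ BV∈τ
      (vertices (separates AB∈τ) , covers-edges (separates AB∈τ))
    ... | inj₂ VB∈τ = not-two VB∈τ VB∈τ ((λ _ → inj₁ tt) , (λ _ → inj₁ (tt , tt)))

    -- A vertex other than `root` has an edge, namely the first one on a walk to `root`. If the
    -- vertex is in `B` but not in `A`, that edge lies in `E[ G ] B`. So finitely many edges there
    -- would make `B` finite.
    big-side-edges-infinite : (A , B) ∈ members → ¬ FiniteE G (E[ G ] B)
    big-side-edges-infinite {A} {B} AB∈τ E[B]-finite = big-side-infinite AB∈τ
      (FiniteV-⊆ B⊆ (∪-finite (vertexSetoid G) (finite-order s)
        (∪-finite (vertexSetoid G) (V⟨⟩-finite E[B]-finite) (root ∷ [] , id , id))))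
      where
      s = separates AB∈τ
      root = proj₁ connected

      B⊆ : B ⊆ (A ∩ B) ∪ (V⟨ G ⟩ (E[ G ] B) ∪ (_∈ⱽ root ∷ []))
      B⊆ {v} v∈B with em {P = v ∈ A}
      ... | yes v∈A = inj₁ (v∈A , v∈B)
      ... | no  v∉A with proj₂ connected v root
      ...   | ε     = inj₂ (inj₂ (here refl))
      ...   | a ◅ _ with covers-edges s (edge a)
      ...     | inj₁ (v∈A , _) = contradiction v∈A v∉A
      ...     | inj₂ e∈B       = inj₂ (inj₁ (edge a , e∈B , inj₁ refl))

    -- With the opposite orientation, the small sides `A`, `C` and `B ∩ D` would cover G, a
    -- contradiction of order 3.
    ∩-big-side : (A , B) ∈ members → (C , D) ∈ members → (A ∪ C , B ∩ D) ∈ members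
    ∩-big-side {A} {B} {C} {D} AB∈τ CD∈τ = [ id , (λ r → contradiction
        (Sum.assocʳ ∘ vertices sep , edges-split)
        (not-three AB∈τ CD∈τ r)) ] (orients sep)
      where
      s = separates AB∈τ
      t = separates CD∈τ

      edges-split : ∀ e → e ∈ E[ G ] A ∪ E[ G ] C ∪ E[ G ] (B ∩ D)
      edges-split e with covers-edges s e | covers-edges t e
      ... | inj₁ e∈A       | _               = inj₁ e∈A
      ... | inj₂ _         | inj₁ e∈C        = inj₂ (inj₁ e∈C)
      ... | inj₂ (x , y)   | inj₂ (x′ , y′)  = inj₂ (inj₂ ((x , x′) , (y , y′)))

      sep : IsFiniteSeparation G (A ∪ C) (B ∩ D)
      sep = record
        { vertices     = λ v → case (vertices s v , vertices t v) of λ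
            { (inj₁ v∈A , _)        → inj₁ (inj₁ v∈A)
            ; (inj₂ _   , inj₁ v∈C) → inj₁ (inj₂ v∈C)
            ; (inj₂ v∈B , inj₂ v∈D) → inj₂ (v∈B , v∈D) }
        ; edges        = λ e → case edges-split e of λ
            { (inj₁ (x , y))        → inj₁ (inj₁ x , inj₁ y)
            ; (inj₂ (inj₁ (x , y))) → inj₁ (inj₂ x , inj₂ y)
            ; (inj₂ (inj₂ e∈B∩D))   → inj₂ e∈B∩D }
        ; finite-order = FiniteV-⊆
            (λ { (inj₁ v∈A , v∈B , _) → inj₁ (v∈A , v∈B)
               ; (inj₂ v∈C , _ , v∈D) → inj₂ (v∈C , v∈D) })
            (∪-finite (vertexSetoid G) (finite-order s) (finite-order t))
        }

    Large : Pred (EdgeSep G) (Level.suc ℓ)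
    Large E = ∃[ A ] ∃[ B ] (A , B) ∈ members × E[ G ] B ⊆* edges E

    -- Whichever way `τ` orients the canonical separation of `E`, the edges of its big side are
    -- almost contained in `E` or in its complement.
    Large-prime : ∀ E → E ∈ Large ⊎ (¬ᴮ E) ∈ Large
    Large-prime E = Sum.map
      (λ AB∈τ → outside E , inside E , AB∈τ , E[inside]⊆* E)
      (λ BA∈τ → inside E , outside E , BA∈τ , E[outside]⊆* E)
      (orients (canonicalSeparation E))

    Large-isFilter : IsFilter 𝔗 Large
    Large-isFilter = record
      -- Primality at any element yields a member; `⊥` is an arbitrary choice.
      { nonempty = case Large-prime ⊥ of λ
          { (inj₁ ⊥∈) → ⊥ , ⊥∈ ; (inj₂ ¬⊥∈) → (¬ᴮ ⊥) , ¬⊥∈ }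
      ; upward   = λ {E} {F} E≤F (A , B , AB∈τ , B⊆*E) →
          A , B , AB∈τ , ⊆*-trans (E[]-resp B) (resp F) B⊆*E (≤⇒⊆* E F E≤F)
      ; ∧-closed = λ {E} {F} (A , B , AB∈τ , B⊆*E) (C , D , CD∈τ , D⊆*F) →
          A ∪ C , B ∩ D , ∩-big-side AB∈τ CD∈τ ,
          FiniteE-⊆ (∖-resp (E[]-resp (B ∩ D)) (resp (E ∧ F)))
            (λ { {e} (((x∈B , x∈D) , (y∈B , y∈D)) , e∉E∩F) → case em {P = e ∈ edges E} of λ
              { (yes e∈E) → inj₂ ((x∈D , y∈D) , λ e∈F → e∉E∩F (e∈E , e∈F))
              ; (no  e∉E) → inj₁ ((x∈B , y∈B) , e∉E) } })
            (∪-finite (edgeSetoid G) B⊆*E D⊆*F)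
      ; ⊥∉       = λ (A , B , AB∈τ , B⊆*⊥) → big-side-edges-infinite AB∈τ
          (FiniteE-⊆ (E[]-resp B) (λ e∈B → e∈B , λ ()) B⊆*⊥)
      }

    inducedUltrafilter : Ultrafilter 𝔗
    inducedUltrafilter = prime⇒ultrafilter 𝔗 Large-isFilter Large-prime

    -- If `τ` contained `(B , A)`, then `E[ G ] A`, being almost disjoint from `E[ G ] B`, would
    -- make the complement of `E[ G ] B` large as well.
    side∈Large⇒member : (s : IsFiniteSeparation G A B) → sideEdges s ∈ Large → (A , B) ∈ members
    side∈Large⇒member {A} {B} s B∈Large = [ id , (λ BA∈τ → contradiction
        (B , A , BA∈τ , sides-almost-disjoint s)
        (x∈filter⇒¬x∉filter 𝔗 Large-isFilter {sideEdges s} B∈Large)) ] (orients s)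

    -- Together with `subbasic⇒Large` this identifies the preimage of the basic open set [E] with a
    -- single subbasic set, which makes `inducedUltrafilter` continuous.
    Large⇒subbasic : ∀ E → E ∈ Large → τ ∈ subbasicOpen G (canonicalIndex E)
    Large⇒subbasic E E∈Large = members-resp (outside≐ E) (inside≐ E)
      (side∈Large⇒member s (IsFilter.upward Large-isFilter {E} {sideEdges s}
        (⊆*⇒≤ E (sideEdges s) (∅-finite (edgeSetoid G) λ (e∈E , e∉) → e∉ (⊆E[V⟨⟩] e∈E))) E∈Large))
      where s = canonicalSeparation E

    subbasic⇒Large : ∀ E → τ ∈ subbasicOpen G (canonicalIndex E) → E ∈ Large
    subbasic⇒Large E k∋τ = outside E , inside E ,
      members-resp (≐-sym (outside≐ E)) (≐-sym (inside≐ E)) k∋τ , E[inside]⊆* E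

  -- Continuity and the homeomorphism

  -- Continuity of `inducedTangle` on basic sets: `E` is the meet of the big-side edge sets of the
  -- listed separations with some member of `u`.
  inducedTangle-subbasic-neighbourhood : ∀ ks u →
    All (λ k → inducedTangle u ∈ subbasicOpen G k) ks →
    ∃[ E ] E ∈ Ultrafilter.members u ×
      (∀ w → E ∈ Ultrafilter.members w → All (λ k → inducedTangle w ∈ subbasicOpen G k) ks)
  inducedTangle-subbasic-neighbourhood [] u [] =
    let (E , E∈u) = IsFilter.nonempty (Ultrafilter.isFilter u) in E , E∈u , λ _ _ → []
  inducedTangle-subbasic-neighbourhood (k ∷ ks) u ((s , B∈u) ∷ u∈ks) =
    let (E , E∈u , E⊆ks) = inducedTangle-subbasic-neighbourhood ks u u∈ks in
    sideEdges s ∧ E ,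
    IsFilter.∧-closed (Ultrafilter.isFilter u) {sideEdges s} {E} B∈u E∈u ,
    λ w B∧E∈w →
      (s , ⊆*-upward w (sideEdges s ∧ E) (sideEdges s)
        (∅-finite (edgeSetoid G) λ ((e∈B , _) , e∉B) → e∉B e∈B) B∧E∈w) ∷
      E⊆ks w (⊆*-upward w (sideEdges s ∧ E) E
        (∅-finite (edgeSetoid G) λ ((_ , e∈E) , e∉E) → e∉E e∈E) B∧E∈w)

theorem8 : ∀ {ℓ} (em : ∀ {a} → ExcludedMiddle a) (G : Graph ℓ) → Connected G → Homeomorphism (Ult (separationAlgebra G em)) (Θ G)
theorem8 em G connected = record
  { inverse         = record
    { to        = to
    ; from      = from
    ; to-cong   = λ {u} {w} → to-cong {u} {w}
    ; from-cong = λ {σ} {τ} → from-cong {σ} {τ}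
    ; inverse   =
        (λ {τ} {u} u≈from → ≐-trans (to-cong {u} {from τ} u≈from) (to∘from τ))
      , (λ {u} {τ} τ≈to → ≐-trans (from-cong {τ} {to u} τ≈to) (from∘to u))
    }
  ; to-continuous   = λ W-open {u} τᵤ∈W →
      let (ks , τᵤ∈ks , ks⊆W) = W-open τᵤ∈W
          (E , E∈u , E⊆ks)    = inducedTangle-subbasic-neighbourhood em G ks u τᵤ∈ks
      in E , E∈u , λ {w} E∈w → ks⊆W (E⊆ks w E∈w)
  ; from-continuous = λ W-open {τ} u∈W →
      let (E , E∈u , E⊆W) = W-open u∈W in
      canonicalIndex em G E ∷ [] , Large⇒subbasic em G connected τ E E∈u ∷ [] ,
      λ { {σ} (k∋σ ∷ []) → E⊆W {from σ} (subbasic⇒Large em G connected σ E k∋σ) }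
  }
  where
  𝔗 = separationAlgebra G em

  to : Ultrafilter 𝔗 → Tangle G
  to = inducedTangle em G

  from : Tangle G → Ultrafilter 𝔗
  from = inducedUltrafilter em G connected

  to-cong : ∀ {u w} → Ultrafilter.members u ≐ Ultrafilter.members w →
            Tangle.members (to u) ≐ Tangle.members (to w)
  to-cong (u⊆w , w⊆u) = (λ (s , B∈u) → s , u⊆w B∈u) , (λ (s , B∈w) → s , w⊆u B∈w)

  from-cong : ∀ {σ τ} → Tangle.members σ ≐ Tangle.members τ →
              Ultrafilter.members (from σ) ≐ Ultrafilter.members (from τ)
  from-cong (σ⊆τ , τ⊆σ) =
    (λ (A , B , AB∈σ , B⊆*E) → A , B , σ⊆τ AB∈σ , B⊆*E) ,
    (λ (A , B , AB∈τ , B⊆*E) → A , B , τ⊆σ AB∈τ , B⊆*E)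

  to∘from : ∀ τ → Tangle.members (to (from τ)) ≐ Tangle.members τ
  to∘from τ =
    (λ (s , B∈Large) → side∈Large⇒member em G connected τ s B∈Large) ,
    -- The pair `(A , B)` itself witnesses that `E[ G ] B` is large.
    (λ {(A , B)} AB∈τ → IsOrientation.separates (Tangle.isOrientation τ) AB∈τ ,
      A , B , AB∈τ , ∅-finite (edgeSetoid G) λ (e∈B , e∉B) → e∉B e∈B)

  from∘to : ∀ u → Ultrafilter.members (from (to u)) ≐ Ultrafilter.members u
  from∘to u = ⊆u , u⊆
    where
    ⊆u : Ultrafilter.members (from (to u)) ⊆ Ultrafilter.members u
    ⊆u {E} (A , B , (s , B∈u) , B⊆*E) = ⊆*-upward em G u (sideEdges em G s) E B⊆*E B∈u

    u⊆ : Ultrafilter.members u ⊆ Ultrafilter.members (from (to u))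
    -- Were `E` not large, its complement would be, and `⊆u` would put that complement in `u` next
    -- to `E`.
    u⊆ {E} E∈u with Large-prime em G connected (to u) E
    ... | inj₁ E∈Large  = E∈Large
    ... | inj₂ ∁E∈Large = contradiction (⊆u {BooleanAlgebra.¬_ 𝔗 E} ∁E∈Large)
      (x∈filter⇒¬x∉filter 𝔗 (Ultrafilter.isFilter u) {E} E∈u)
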